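{- Let $\alpha,\beta\ge 2$, let $\kappa=\kappa(\alpha,\beta)$ be the complete bipartite graph on $\alpha$ white and $\beta$ black vertices, and let $TC(\kappa)$ be its associated tile complex. Then the reduced (integral) homology groups of $TC(\kappa)$ are $$\tilde H_n(TC(\kappa))\cong\begin{cases}0 & n=0,\\ \mathbb Z^{\alpha+\beta-2} & n=1,\\ \mathbb Z^{(\alpha-1)(\beta-1)} & n=2,\\ 0 & n\ge 3.\end{cases}$$
   Context: The tile complex $TC(\kappa)$ is the two-dimensional CW-complex obtained as follows. For each pair $(i,j)$, $1\le i\le\alpha$, $1\le j\le\beta$ (i.e. each edge of $\kappa$), take a solid square $A_{ij}$ whose boundary edges, read anticlockwise from a base vertex, are labelled $u_i^1,v_j^1,u_i^2,v_j^2$, each edge directed forward (anticlockwise). The labels $u_i^1,u_i^2$ ($1\le i\le\alpha$) and $v_j^1,v_j^2$ ($1\le j\le\beta$) are all distinct. Then $TC(\kappa)$ is the quotient of the disjoint union of these $\alpha\beta$ squares obtained by gluing together all edges with the same label, respecting their direction. -}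

module Defs where

open import Level using (0ℓ)
open import Algebra.Bundles using (AbelianGroup)
open import Algebra.Morphism.Bundles using (GroupHomomorphism)
open import Algebra.Morphism.Structures using (IsGroupIsomorphism)
import Algebra.Construct.Pointwise as Pointwise
import Algebra.Construct.Terminal as Terminal
import Algebra.Properties.AbelianGroup as AbelianGroupProperties
import Algebra.Properties.CommutativeSemigroup as CommutativeSemigroupProperties
import Algebra.Properties.CommutativeMonoid.Sum as Sum
import Algebra.Morphism.Construct.Composition as Composition
open import Data.Empty using (⊥)
open import Data.Fin.Base using (Fin)
open import Data.Fin.Patterns using (0F; 1F; 2F; 3F)
open import Data.Integer.Base using (1ℤ)
import Data.Integer.Properties as ℤ
open import Data.Nat.Base using (ℕ; zero; suc)
open import Data.Product.Base using (Σ; ∃; _×_; _,_; proj₁; proj₂)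
open import Function.Bundles using (Func)
open import Relation.Binary.Bundles using (Setoid)
import Relation.Binary.Construct.Closure.Equivalence as EqClosure
import Relation.Binary.Construct.On as On
open import Relation.Binary.PropositionalEquality as ≡ using (_≡_)
import Relation.Binary.Reasoning.Setoid as SetoidReasoning

Ab : Set₁
Ab = AbelianGroup 0ℓ 0ℓ

Hom : Ab → Ab → Set
Hom A B = GroupHomomorphism (AbelianGroup.rawGroup A) (AbelianGroup.rawGroup B)

infix 4 _≅_
_≅_ : Ab → Ab → Set
A ≅ B = ∃ (IsGroupIsomorphism (AbelianGroup.rawGroup A) (AbelianGroup.rawGroup B))

𝟎 : Ab
𝟎 = Terminal.abelianGroup

infix 8 ℤ^_
ℤ^_ : ℕ → Ab
ℤ^ k = Pointwise.abelianGroup (Fin k) ℤ.+-0-abelianGroup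

-- The free abelian group on a setoid: group words modulo the congruence
-- generated by the abelian group laws and the equality of generators.

module FreeAb (X : Setoid 0ℓ 0ℓ) where
  private module X = Setoid X

  infixl 6 _⊕_
  infix  8 ⊖_
  infix  4 _∼_

  data Word : Set where
    gen : X.Carrier → Word
    𝟘   : Word
    _⊕_ : Word → Word → Word
    ⊖_  : Word → Word

  data _∼_ : Word → Word → Set where
    ∼-refl    : ∀ {x} → x ∼ x
    ∼-sym     : ∀ {x y} → x ∼ y → y ∼ x
    ∼-trans   : ∀ {x y z} → x ∼ y → y ∼ z → x ∼ z
    gen-cong  : ∀ {a b} → a X.≈ b → gen a ∼ gen b
    ⊕-cong    : ∀ {x x′ y y′} → x ∼ x′ → y ∼ y′ → x ⊕ y ∼ x′ ⊕ y′
    ⊖-cong    : ∀ {x x′} → x ∼ x′ → ⊖ x ∼ ⊖ x′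
    ⊕-assoc   : ∀ x y z → (x ⊕ y) ⊕ z ∼ x ⊕ (y ⊕ z)
    ⊕-comm    : ∀ x y → x ⊕ y ∼ y ⊕ x
    ⊕-identʳ  : ∀ x → x ⊕ 𝟘 ∼ x
    ⊕-invʳ    : ∀ x → x ⊕ (⊖ x) ∼ 𝟘

  abelianGroup : Ab
  abelianGroup = record
    { Carrier = Word ; _≈_ = _∼_ ; _∙_ = _⊕_ ; ε = 𝟘 ; _⁻¹ = ⊖_
    ; isAbelianGroup = record
      { isGroup = record
        { isMonoid = record
          { isSemigroup = record
            { isMagma = record
              { isEquivalence = record { refl = ∼-refl ; sym = ∼-sym ; trans = ∼-trans }
              ; ∙-cong = ⊕-cong
              }
            ; assoc = ⊕-assoc
            }
          ; identity = (λ x → ∼-trans (⊕-comm 𝟘 x) (⊕-identʳ x)) , ⊕-identʳ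
          }
        ; inverse = (λ x → ∼-trans (⊕-comm (⊖ x) x) (⊕-invʳ x)) , ⊕-invʳ
        ; ⁻¹-cong = ⊖-cong
        }
      ; comm = ⊕-comm
      }
    }

  module _ (G : Ab) where
    open AbelianGroup G

    extend : (f : Func X setoid) → Hom abelianGroup G
    extend f = record
      { ⟦_⟧ = ⟦_⟧
      ; isGroupHomomorphism = record
        { isMonoidHomomorphism = record
          { isMagmaHomomorphism = record
            { isRelHomomorphism = record { cong = ⟦⟧-cong }
            ; homo = λ _ _ → refl
            }
          ; ε-homo = refl
          }
        ; ⁻¹-homo = λ _ → refl
        }
      }
      where
      ⟦_⟧ : Word → Carrier
      ⟦ gen a ⟧ = Func.to f a
      ⟦ 𝟘 ⟧     = ε
      ⟦ x ⊕ y ⟧ = ⟦ x ⟧ ∙ ⟦ y ⟧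
      ⟦ ⊖ x ⟧   = ⟦ x ⟧ ⁻¹

      ⟦⟧-cong : ∀ {x y} → x ∼ y → ⟦ x ⟧ ≈ ⟦ y ⟧
      ⟦⟧-cong ∼-refl           = refl
      ⟦⟧-cong (∼-sym p)        = sym (⟦⟧-cong p)
      ⟦⟧-cong (∼-trans p q)    = trans (⟦⟧-cong p) (⟦⟧-cong q)
      ⟦⟧-cong (gen-cong p)     = Func.cong f p
      ⟦⟧-cong (⊕-cong p q)     = ∙-cong (⟦⟧-cong p) (⟦⟧-cong q)
      ⟦⟧-cong (⊖-cong p)       = ⁻¹-cong (⟦⟧-cong p)
      ⟦⟧-cong (⊕-assoc x y z)  = assoc ⟦ x ⟧ ⟦ y ⟧ ⟦ z ⟧
      ⟦⟧-cong (⊕-comm x y)     = comm ⟦ x ⟧ ⟦ y ⟧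
      ⟦⟧-cong (⊕-identʳ x)     = identityʳ ⟦ x ⟧
      ⟦⟧-cong (⊕-invʳ x)       = inverseʳ ⟦ x ⟧

  vanish : (G : Ab) (h : Hom abelianGroup G) →
           let module G = AbelianGroup G
               module h = GroupHomomorphism h in
           (∀ a → h.⟦ gen a ⟧ G.≈ G.ε) → ∀ x → h.⟦ x ⟧ G.≈ G.ε
  vanish G h p = go
    where
    open AbelianGroup G
    open GroupHomomorphism h using (⟦_⟧; homo; ε-homo; ⁻¹-homo)
    open AbelianGroupProperties G using (ε⁻¹≈ε)

    go : ∀ x → ⟦ x ⟧ ≈ ε
    go (gen a) = p a
    go 𝟘       = ε-homo
    go (x ⊕ y) = trans (homo x y) (trans (∙-cong (go x) (go y)) (identityʳ ε))
    go (⊖ x)   = trans (⁻¹-homo x) (trans (⁻¹-cong (go x)) ε⁻¹≈ε)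

record ChainComplex : Set₁ where
  field
    C : ℕ → Ab
    ∂ : ∀ n → Hom (C (suc n)) (C n)

  module C n = AbelianGroup (C n)
  module ∂ n = GroupHomomorphism (∂ n)

  field
    ∂∂≈0 : ∀ n x → C._≈_ n (∂.⟦_⟧ n (∂.⟦_⟧ (suc n) x)) (C.ε n)

module _ (A B D : Ab) (f : Hom A B) (g : Hom B D) where
  private
    module A = AbelianGroup A
    module D = AbelianGroup D
    module f = GroupHomomorphism f
    module g = GroupHomomorphism g
    open AbelianGroup B
    open AbelianGroupProperties B
    open CommutativeSemigroupProperties commutativeSemigroup using (interchange)

  -- ker g / im f, for g ∘ f zero: elements of the kernel, equal when
  -- their difference lies in the image.
  ker/im : (∀ x → g.⟦ f.⟦ x ⟧ ⟧ D.≈ D.ε) → Ab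
  ker/im _ = record
    { Carrier = Ker ; _≈_ = _≋_ ; _∙_ = _∙ᴷ_ ; ε = εᴷ ; _⁻¹ = _⁻¹ᴷ
    ; isAbelianGroup = record
      { isGroup = record
        { isMonoid = record
          { isSemigroup = record
            { isMagma = record
              { isEquivalence = record
                { refl = λ {x} → fromB x x refl
                ; sym = λ {x} {y} → ≋-sym x y
                ; trans = λ {x} {y} {z} → ≋-trans x y z
                }
              ; ∙-cong = λ {x} {x′} {y} {y′} → ≋-∙-cong x x′ y y′
              }
            ; assoc = λ x y z → fromB ((x ∙ᴷ y) ∙ᴷ z) (x ∙ᴷ (y ∙ᴷ z)) (assoc _ _ _)
            }
          ; identity = (λ x → fromB (εᴷ ∙ᴷ x) x (identityˡ _))
                     , (λ x → fromB (x ∙ᴷ εᴷ) x (identityʳ _))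
          }
        ; inverse = (λ x → fromB ((x ⁻¹ᴷ) ∙ᴷ x) εᴷ (inverseˡ _))
                  , (λ x → fromB (x ∙ᴷ (x ⁻¹ᴷ)) εᴷ (inverseʳ _))
        ; ⁻¹-cong = λ {x} {y} → ≋-⁻¹-cong x y
        }
      ; comm = λ x y → fromB (x ∙ᴷ y) (y ∙ᴷ x) (comm _ _)
      }
    }
    where
    Ker : Set
    Ker = Σ Carrier (λ x → g.⟦ x ⟧ D.≈ D.ε)

    _≋_ : Ker → Ker → Set
    (x , _) ≋ (y , _) = ∃ λ a → f.⟦ a ⟧ ≈ x - y

    _∙ᴷ_ : Ker → Ker → Ker
    (x , p) ∙ᴷ (y , q) =
      x ∙ y , D.trans (g.homo x y) (D.trans (D.∙-cong p q) (D.identityʳ D.ε))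

    εᴷ : Ker
    εᴷ = ε , g.ε-homo

    _⁻¹ᴷ : Ker → Ker
    (x , p) ⁻¹ᴷ =
      x ⁻¹ , D.trans (g.⁻¹-homo x)
               (D.trans (D.⁻¹-cong p) (AbelianGroupProperties.ε⁻¹≈ε D))

    fromB : ∀ x y → proj₁ x ≈ proj₁ y → x ≋ y
    fromB _ _ x≈y = A.ε , trans f.ε-homo (sym (x≈y⇒x∙y⁻¹≈ε x≈y))

    ≋-sym : ∀ x y → x ≋ y → y ≋ x
    ≋-sym (x , _) (y , _) (a , p) =
      a A.⁻¹ , trans (f.⁻¹-homo a) (trans (⁻¹-cong p) (⁻¹-anti-homo‿- x y))

    ≋-trans : ∀ x y z → x ≋ y → y ≋ z → x ≋ z
    ≋-trans (x , _) (y , _) (z , _) (a , p) (b , q) = a A.∙ b , (begin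
      f.⟦ a A.∙ b ⟧          ≈⟨ f.homo a b ⟩
      f.⟦ a ⟧ ∙ f.⟦ b ⟧      ≈⟨ ∙-cong p q ⟩
      (x - y) ∙ (y - z)      ≈⟨ assoc _ _ _ ⟨
      (x - y) ∙ y ∙ z ⁻¹     ≈⟨ ∙-congʳ (//-rightDividesˡ y x) ⟩
      x - z                  ∎)
      where open SetoidReasoning setoid

    ≋-∙-cong : ∀ x x′ y y′ → x ≋ x′ → y ≋ y′ → (x ∙ᴷ y) ≋ (x′ ∙ᴷ y′)
    ≋-∙-cong (x , _) (x′ , _) (y , _) (y′ , _) (a , p) (b , q) = a A.∙ b , (begin
      f.⟦ a A.∙ b ⟧                ≈⟨ f.homo a b ⟩
      f.⟦ a ⟧ ∙ f.⟦ b ⟧            ≈⟨ ∙-cong p q ⟩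
      (x - x′) ∙ (y - y′)          ≈⟨ interchange _ _ _ _ ⟩
      (x ∙ y) ∙ (x′ ⁻¹ ∙ y′ ⁻¹)    ≈⟨ ∙-congˡ (⁻¹-∙-comm x′ y′) ⟩
      (x ∙ y) - (x′ ∙ y′)          ∎)
      where open SetoidReasoning setoid

    ≋-⁻¹-cong : ∀ x y → x ≋ y → (x ⁻¹ᴷ) ≋ (y ⁻¹ᴷ)
    ≋-⁻¹-cong (x , _) (y , _) (a , p) =
      a A.⁻¹ , trans (f.⁻¹-homo a) (trans (⁻¹-cong p) (sym (⁻¹-∙-comm x (y ⁻¹))))

-- Indexed so that homology K n is the homology at C (suc n).
homology : ChainComplex → ℕ → Ab
homology K n = ker/im (C (suc (suc n))) (C (suc n)) (C n) (∂ (suc n)) (∂ n) (∂∂≈0 n)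
  where open ChainComplex K

-- Each square has corners 0F … 3F in anticlockwise order, starting at its
-- base vertex, and its k-th boundary edge runs from corner k to corner
-- next k.  All edges with the same label are glued, respecting direction.

next : Fin 4 → Fin 4
next 0F = 1F
next 1F = 2F
next 2F = 3F
next 3F = 0F

record LabelledSquares : Set₁ where
  field
    Square : Set
    Label  : Set
    label  : Square → Fin 4 → Label

  Edge Corner : Set
  Edge   = Square × Fin 4
  Corner = Square × Fin 4

  edgeLabel : Edge → Label
  edgeLabel (s , k) = label s k

  source target : Edge → Corner
  source (s , k) = s , k
  target (s , k) = s , next k

  data Glued : Corner → Corner → Set where
    sources : ∀ {e e′} → edgeLabel e ≡ edgeLabel e′ → Glued (source e) (source e′)
    targets : ∀ {e e′} → edgeLabel e ≡ edgeLabel e′ → Glued (target e) (target e′)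

  -- The open n-cells of the quotient space.  Edges are identified exactly
  -- when their labels agree; corners are identified by the equivalence
  -- relation that the gluing generates.
  Cell : ℕ → Setoid 0ℓ 0ℓ
  Cell 0 = EqClosure.setoid Glued
  Cell 1 = On.setoid (≡.setoid Label) edgeLabel
  Cell 2 = ≡.setoid Square
  Cell (suc (suc (suc _))) = ≡.setoid ⊥

  Chains : ℕ → Ab
  Chains n = FreeAb.abelianGroup (Cell n)

  augmentation : Hom (Chains 0) ℤ.+-0-abelianGroup
  augmentation = FreeAb.extend (Cell 0) ℤ.+-0-abelianGroup
    (record { to = λ _ → 1ℤ ; cong = λ _ → ≡.refl })

  -- The cellular boundary: an edge goes to target − source, and a square,
  -- whose attaching map traverses its four edges once each in the forward
  -- direction, goes to the sum of those edges.
  boundary : ∀ n → Hom (Chains (suc n)) (Chains n)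
  boundary 0 = FreeAb.extend (Cell 1) (Chains 0) (record
    { to   = λ e → gen (target e) - gen (source e)
    ; cong = λ {e} {e′} p →
        ∙-cong (gen-cong (EqClosure.return (targets {e} {e′} p)))
               (⁻¹-cong (gen-cong (EqClosure.return (sources {e} {e′} p))))
    })
    where
    open FreeAb (Cell 0) using (gen; gen-cong)
    open AbelianGroup (Chains 0) using (_-_; ∙-cong; ⁻¹-cong)
  boundary 1 = FreeAb.extend (Cell 2) (Chains 1) (record
    { to   = λ s → sum (λ k → gen (s , k))
    ; cong = λ { ≡.refl → refl }
    })
    where
    open FreeAb (Cell 1) using (gen)
    open AbelianGroup (Chains 1) using (refl; commutativeMonoid)
    open Sum commutativeMonoid using (sum)
  boundary (suc (suc n)) = FreeAb.extend (Cell (suc (suc (suc n)))) (Chains (suc (suc n)))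
    (record { to = λ () ; cong = λ { {()} } })

  private
    compose-zero : ∀ X (B D : Ab) (f : Hom (FreeAb.abelianGroup X) B) (g : Hom B D) →
      let module D = AbelianGroup D
          module f = GroupHomomorphism f
          module g = GroupHomomorphism g in
      (∀ a → g.⟦ f.⟦ FreeAb.gen a ⟧ ⟧ D.≈ D.ε) → ∀ x → g.⟦ f.⟦ x ⟧ ⟧ D.≈ D.ε
    compose-zero X B D f g = FreeAb.vanish X D (record
      { ⟦_⟧ = λ x → g.⟦ f.⟦ x ⟧ ⟧
      ; isGroupHomomorphism =
          Composition.isGroupHomomorphism (AbelianGroup.trans D)
            f.isGroupHomomorphism g.isGroupHomomorphism
      })
      where
      module f = GroupHomomorphism f
      module g = GroupHomomorphism g

    boundary-of-square : ∀ s →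
      let module C₀ = AbelianGroup (Chains 0)
          module ∂₀ = GroupHomomorphism (boundary 0)
          module ∂₁ = GroupHomomorphism (boundary 1) in
      ∂₀.⟦ ∂₁.⟦ FreeAb.gen s ⟧ ⟧ C₀.≈ C₀.ε
    boundary-of-square s = begin
      (b - a) ∙ ((c - b) ∙ ((d - c) ∙ ((a - d) ∙ 0#)))  ≈⟨ ∙-congˡ (∙-congˡ (∙-congˡ (identityʳ _))) ⟩
      (b - a) ∙ ((c - b) ∙ ((d - c) ∙ (a - d)))         ≈⟨ ∙-congˡ (∙-congˡ (telescope c d a)) ⟩
      (b - a) ∙ ((c - b) ∙ (a - c))                     ≈⟨ ∙-congˡ (telescope b c a) ⟩
      (b - a) ∙ (a - b)                                 ≈⟨ telescope a b a ⟩
      a - a                                             ≈⟨ inverseʳ a ⟩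
      0#                                                ∎
      where
      open AbelianGroup (Chains 0) renaming (ε to 0#)
      open AbelianGroupProperties (Chains 0) using (//-rightDividesˡ)
      open SetoidReasoning setoid
      open FreeAb (Cell 0) using (gen)
      a b c d : Carrier
      a = gen (s , 0F)
      b = gen (s , 1F)
      c = gen (s , 2F)
      d = gen (s , 3F)

      telescope : ∀ x y z → (y - x) ∙ (z - y) ≈ z - x
      telescope x y z = begin
        (y - x) ∙ (z - y)   ≈⟨ comm _ _ ⟩
        (z - y) ∙ (y - x)   ≈⟨ assoc _ _ _ ⟨
        (z - y) ∙ y - x     ≈⟨ ∙-congʳ (//-rightDividesˡ y z) ⟩
        z - x               ∎

  -- The augmented cellular chain complex, shifted: index 0 is degree −1,
  -- and index suc n is degree n.
  augmented : ChainComplex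
  augmented = record { C = Ĉ ; ∂ = ∂̂ ; ∂∂≈0 = ∂̂∂̂≈0 }
    where
    Ĉ : ℕ → Ab
    Ĉ zero    = ℤ.+-0-abelianGroup
    Ĉ (suc n) = Chains n

    ∂̂ : ∀ n → Hom (Ĉ (suc n)) (Ĉ n)
    ∂̂ zero    = augmentation
    ∂̂ (suc n) = boundary n

    ∂̂∂̂≈0 : ∀ n x →
      let module Cₙ = AbelianGroup (Ĉ n)
          module ∂ₙ = GroupHomomorphism (∂̂ n)
          module ∂ₙ₊₁ = GroupHomomorphism (∂̂ (suc n)) in
      ∂ₙ.⟦ ∂ₙ₊₁.⟦ x ⟧ ⟧ Cₙ.≈ Cₙ.ε
    ∂̂∂̂≈0 0 = compose-zero (Cell 1) (Ĉ 1) (Ĉ 0) (boundary 0) augmentation (λ _ → ≡.refl)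
    ∂̂∂̂≈0 1 = compose-zero (Cell 2) (Ĉ 2) (Ĉ 1) (boundary 1) (boundary 0) boundary-of-square
    ∂̂∂̂≈0 (suc (suc n)) = compose-zero (Cell (suc (suc (suc n)))) (Ĉ (suc (suc (suc n)))) (Ĉ (suc (suc n)))
      (boundary (suc (suc n))) (boundary (suc n)) λ ()

  reducedHomology : ℕ → Ab
  reducedHomology = homology augmented

record BipartiteGraph : Set₁ where
  field
    White Black Edge : Set
    white : Edge → White
    black : Edge → Black

κ : ℕ → ℕ → BipartiteGraph
κ α β = record
  { White = Fin α
  ; Black = Fin β
  ; Edge  = Fin α × Fin β
  ; white = proj₁
  ; black = proj₂
  }

module _ (G : BipartiteGraph) where
  open BipartiteGraph G

  data TileLabel : Set where
    u¹ u² : White → TileLabel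
    v¹ v² : Black → TileLabel

  TC : LabelledSquares
  TC = record { Square = Edge ; Label = TileLabel ; label = tileLabel }
    where
    tileLabel : Edge → Fin 4 → TileLabel
    tileLabel e 0F = u¹ (white e)
    tileLabel e 1F = v¹ (black e)
    tileLabel e 2F = u² (white e)
    tileLabel e 3F = v² (black e)

H̃ : ℕ → LabelledSquares → Ab
H̃ n X = LabelledSquares.reducedHomology X n

{-# OPTIONS --safe #-}
module Submission where

-- Gluing leaves four vertices, one for each corner position, and the edges
-- u¹ i, v¹ j, u² i, v² j; write A i j for the squares and let 0 be a base index.
-- In degree 1 the complex retracts onto the classes of the cycles u² i − u² 0 and
-- v² j − v² 0, where u¹ i counts as − u² i modulo boundaries; in degree 2 onto
-- the cycles A i j − A i 0 − A 0 j + A 0 0 (i, j ≠ 0).  The contracting homotopy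
-- sends a vertex to the path reaching it along the boundary of A 0 0, and u¹ i,
-- v¹ j, u² i, v² j to A i 0 − A 0 0, A 0 j − A 0 0, 0, A 0 0.  Since all chain
-- groups are free, every identity needs to be checked on generators only.

open import Level using (0ℓ)
open import Algebra.Bundles using (AbelianGroup)
open import Algebra.Morphism.Bundles using (GroupHomomorphism)
import Algebra.Morphism.Construct.Composition as Composition
import Algebra.Morphism.Construct.Identity as Identity
import Algebra.Properties.AbelianGroup as AbelianGroupProperties
import Algebra.Properties.CommutativeMonoid.Sum as Sum
import Algebra.Properties.CommutativeSemigroup as CommutativeSemigroupProperties
import Algebra.Properties.Monoid.Mult as Mult
open import Data.Bool.Base using (if_then_else_)
open import Data.Fin.Base using (Fin; zero; suc)
open import Data.Fin.Patterns using (0F; 1F; 2F; 3F; 4F; 5F; 6F; 7F)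
open import Data.Fin.Properties using (all?; suc-injective; +↔⊎; *↔×) renaming (_≟_ to _≟ᶠ_)
open import Data.Integer.Base using (ℤ; +_; -[1+_]; _⊖_; 0ℤ; 1ℤ) renaming (_+_ to _+ᶻ_; -_ to -ᶻ_)
import Data.Integer.Properties as ℤ
open import Data.Nat.Base using (ℕ; zero; suc; _+_; _*_; _∸_; _≤_; s≤s)
open import Data.Nat.Properties using (+-suc)
open import Data.Product.Base using (_×_; _,_; proj₂)
open import Data.Sum.Base using (_⊎_; inj₁; inj₂)
open import Data.Vec.Base using (Vec; []; _∷_; lookup)
open import Function.Base using (_∘_)
open import Function.Bundles using (Inverse; _↔_)
open import Function.Construct.Identity using (↔-id)
open import Function.Construct.Symmetry using (↔-sym)
open import Relation.Binary.Bundles using (Setoid)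
open import Relation.Binary.PropositionalEquality as ≡ using (_≡_; _≢_)
import Relation.Binary.Construct.Closure.Equivalence as EqClosure
import Relation.Binary.Reasoning.Setoid as SetoidReasoning
open import Relation.Nullary.Decidable.Core using (does; yes; no; True; toWitness)
open import Relation.Nullary.Negation.Core using (contradiction)
open import Defs

∣_∣ : Ab → Set
∣ A ∣ = AbelianGroup.Carrier A

ℤᴬ : Ab
ℤᴬ = ℤ.+-0-abelianGroup

Free : Setoid 0ℓ 0ℓ → Ab
Free X = FreeAb.abelianGroup X

FreeOn : Set → Ab
FreeOn Y = Free (≡.setoid Y)

-- Homomorphisms of abelian groups

-- Preservation of the operation is enough between groups: `h A.ε` is idempotent, hence `ε` by
-- cancellation, and `h (x A.⁻¹)` is then a left inverse of `h x`.
makeHom : (A B : Ab) →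
  let module A = AbelianGroup A
      module B = AbelianGroup B in
  (h : A.Carrier → B.Carrier) →
  (∀ {x y} → x A.≈ y → h x B.≈ h y) →
  (∀ x y → h (x A.∙ y) B.≈ h x B.∙ h y) → Hom A B
makeHom A B h h-cong h-∙ = record
  { ⟦_⟧ = h
  ; isGroupHomomorphism = record
    { isMonoidHomomorphism = record
      { isMagmaHomomorphism = record
        { isRelHomomorphism = record { cong = h-cong }
        ; homo = h-∙
        }
      ; ε-homo = h-ε
      }
    ; ⁻¹-homo = λ x → inverseˡ-unique (h (x A.⁻¹)) (h x)
        (trans (sym (h-∙ (x A.⁻¹) x)) (trans (h-cong (A.inverseˡ x)) h-ε))
    }
  }
  where
  module A = AbelianGroup A
  open AbelianGroup B
  open AbelianGroupProperties B

  h-ε : h A.ε ≈ ε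
  h-ε = begin
    h A.ε                          ≈⟨ //-rightDividesʳ (h A.ε) (h A.ε) ⟨
    h A.ε ∙ h A.ε - h A.ε          ≈⟨ ∙-congʳ (h-∙ A.ε A.ε) ⟨
    h (A.ε A.∙ A.ε) - h A.ε        ≈⟨ ∙-congʳ (h-cong (A.identityˡ A.ε)) ⟩
    h A.ε - h A.ε                  ≈⟨ inverseʳ (h A.ε) ⟩
    ε                              ∎
    where open SetoidReasoning setoid

extendFrom : (Y : Set) (G : Ab) → (Y → ∣ G ∣) → Hom (FreeOn Y) G
extendFrom Y G h = FreeAb.extend (≡.setoid Y) G (record
  { to = h ; cong = AbelianGroup.reflexive G ∘ ≡.cong h })

idHom : (A : Ab) → Hom A A
idHom A = record
  { isGroupHomomorphism = Identity.isGroupHomomorphism _ (AbelianGroup.refl A) }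

compose : (A B D : Ab) → Hom B D → Hom A B → Hom A D
compose A B D g f = record
  { isGroupHomomorphism = Composition.isGroupHomomorphism (AbelianGroup.trans D)
      (GroupHomomorphism.isGroupHomomorphism f) (GroupHomomorphism.isGroupHomomorphism g) }

plus : (A B : Ab) → Hom A B → Hom A B → Hom A B
plus A B f g = makeHom A B (λ x → f.⟦ x ⟧ ∙ g.⟦ x ⟧)
  (λ p → ∙-cong (f.⟦⟧-cong p) (g.⟦⟧-cong p))
  (λ x y → trans (∙-cong (f.homo x y) (g.homo x y)) (interchange _ _ _ _))
  where
  module f = GroupHomomorphism f
  module g = GroupHomomorphism g
  open AbelianGroup B
  open CommutativeSemigroupProperties commutativeSemigroup using (interchange)

zeroHom : (B D : Ab) → Hom B D
zeroHom B D = makeHom B D (λ _ → ε) (λ _ → refl) (λ _ _ → sym (identityʳ ε))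
  where open AbelianGroup D

≅-trans : (A B D : Ab) → A ≅ B → B ≅ D → A ≅ D
≅-trans A B D (_ , p) (_ , q) = _ , Composition.isGroupIsomorphism (AbelianGroup.trans D) p q

module _ (A B : Ab) (h : Hom A B) where
  private module A = AbelianGroup A
  open AbelianGroup B
  open AbelianGroupProperties B
  open GroupHomomorphism h

  hom-minus : ∀ x y → ⟦ x A.- y ⟧ ≈ ⟦ x ⟧ - ⟦ y ⟧
  hom-minus x y = trans (homo x (y A.⁻¹)) (∙-congˡ (⁻¹-homo y))

  -- Equality in `ker/im` speaks of differences; this and the converse below translate it into
  -- equality of images.
  minus-vanishes⇒≈ : ∀ x y → ⟦ x A.- y ⟧ ≈ ε → ⟦ x ⟧ ≈ ⟦ y ⟧
  minus-vanishes⇒≈ x y p = x∙y⁻¹≈ε⇒x≈y _ _ (trans (sym (hom-minus x y)) p)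

  ≈⇒minus-vanishes : ∀ x y → ⟦ x ⟧ ≈ ⟦ y ⟧ → ⟦ x A.- y ⟧ ≈ ε
  ≈⇒minus-vanishes x y p = trans (hom-minus x y) (x≈y⇒x∙y⁻¹≈ε p)

module _ (X : Setoid 0ℓ 0ℓ) (G : Ab) where
  open AbelianGroup G
  open FreeAb X using (Word; gen; 𝟘; _⊕_; ⊖_)

  -- Induction on words: homomorphisms commute with every constructor except `gen`, so only
  -- generators carry information.
  agree : (h k : Hom (Free X) G) →
          let module h = GroupHomomorphism h
              module k = GroupHomomorphism k in
          (∀ a → h.⟦ gen a ⟧ ≈ k.⟦ gen a ⟧) → ∀ x → h.⟦ x ⟧ ≈ k.⟦ x ⟧
  agree h k p = go
    where
    module h = GroupHomomorphism h
    module k = GroupHomomorphism k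
    go : ∀ x → h.⟦ x ⟧ ≈ k.⟦ x ⟧
    go (gen a) = p a
    go 𝟘       = trans h.ε-homo (sym k.ε-homo)
    go (x ⊕ y) = trans (h.homo x y) (trans (∙-cong (go x) (go y)) (sym (k.homo x y)))
    go (⊖ x)   = trans (h.⁻¹-homo x) (trans (⁻¹-cong (go x)) (sym (k.⁻¹-homo x)))

-- Integer multiples and finite linear combinations

module Multiples (G : Ab) where
  open AbelianGroup G
  open AbelianGroupProperties G
  open Mult monoid using (×-homo-+; ×-congˡ) renaming (_×_ to _·_)
  open SetoidReasoning setoid

  infixr 8 _·ᶻ_
  _·ᶻ_ : ℤ → Carrier → Carrier
  (+ n)      ·ᶻ x = n · x
  (-[1+ n ]) ·ᶻ x = (suc n · x) ⁻¹

  -- Integer addition with mixed signs computes to the difference `_⊖_` of naturals, so this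
  -- supplies both mixed cases of `·ᶻ-homo-+`.
  ⊖-·ᶻ : ∀ x m n → (m ⊖ n) ·ᶻ x ≈ m · x - n · x
  ⊖-·ᶻ x m       zero    = sym (trans (∙-congˡ ε⁻¹≈ε) (identityʳ _))
  ⊖-·ᶻ x zero    (suc n) = sym (identityˡ _)
  ⊖-·ᶻ x (suc m) (suc n) = begin
    (suc m ⊖ suc n) ·ᶻ x                 ≡⟨ ≡.cong (_·ᶻ x) (ℤ.[1+m]⊖[1+n]≡m⊖n m n) ⟩
    (m ⊖ n) ·ᶻ x                         ≈⟨ ⊖-·ᶻ x m n ⟩
    -- Adding and removing one further `x` raises both multiples to successors.
    m · x - n · x                        ≈⟨ ∙-congʳ (xyx⁻¹≈y x (m · x)) ⟨
    ((x ∙ m · x) - x) - n · x            ≈⟨ assoc _ _ _ ⟩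
    (x ∙ m · x) ∙ (x ⁻¹ - n · x)         ≈⟨ ∙-congˡ (⁻¹-∙-comm x (n · x)) ⟩
    suc m · x - suc n · x                ∎

  ·ᶻ-homo-+ : ∀ x a b → (a +ᶻ b) ·ᶻ x ≈ a ·ᶻ x ∙ b ·ᶻ x
  ·ᶻ-homo-+ x (+ m)      (+ n)      = ×-homo-+ x m n
  ·ᶻ-homo-+ x (+ m)      (-[1+ n ]) = ⊖-·ᶻ x m (suc n)
  ·ᶻ-homo-+ x (-[1+ m ]) (+ n)      = trans (⊖-·ᶻ x n (suc m)) (comm _ _)
  ·ᶻ-homo-+ x (-[1+ m ]) (-[1+ n ]) = begin
    -- The sum of two negatives computes to `-[1+ suc (m + n) ]`, so one successor has to move
    -- before `×-homo-+` fits.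
    (suc (suc (m + n)) · x) ⁻¹           ≈⟨ ⁻¹-cong (×-congˡ (≡.cong suc (≡.sym (+-suc m n)))) ⟩
    ((suc m + suc n) · x) ⁻¹             ≈⟨ ⁻¹-cong (×-homo-+ x (suc m) (suc n)) ⟩
    (suc m · x ∙ suc n · x) ⁻¹           ≈⟨ ⁻¹-∙-comm _ _ ⟨
    (suc m · x) ⁻¹ - suc n · x           ∎

  multiples : Carrier → Hom ℤᴬ G
  multiples x = makeHom ℤᴬ G (_·ᶻ x) (λ { ≡.refl → refl }) (·ᶻ-homo-+ x)

  open Sum commutativeMonoid using (sum; sum-cong-≋; sum-replicate-zero; ∑-distrib-+)

  combination : ∀ {k} → (Fin k → Carrier) → Hom (ℤ^ k) G
  combination {k} x = makeHom (ℤ^ k) G (λ a → sum (λ i → a i ·ᶻ x i))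
    (λ p → sum-cong-≋ (λ i → GroupHomomorphism.⟦⟧-cong (multiples (x i)) (p i)))
    (λ a b → trans (sum-cong-≋ (λ i → ·ᶻ-homo-+ (x i) (a i) (b i)))
                   (∑-distrib-+ (λ i → a i ·ᶻ x i) (λ i → b i ·ᶻ x i)))

  sum-single : ∀ {k} (x : Fin k → Carrier) j → (∀ i → j ≢ i → x i ≈ ε) → sum x ≈ x j
  sum-single {suc k} x zero    p = trans (∙-congˡ (trans
    (sum-cong-≋ (λ i → p (suc i) λ ())) (sum-replicate-zero k))) (identityʳ _)
  sum-single {suc k} x (suc j) p = trans (∙-congʳ (p zero λ ())) (trans (identityˡ _)
    (sum-single (x ∘ suc) j (λ i j≢i → p (suc i) (j≢i ∘ suc-injective))))

module _ (A B : Ab) (h : Hom A B) where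
  private
    module A where
      open AbelianGroup A public
      open Mult monoid using () renaming (_×_ to _·_) public
      open Sum commutativeMonoid using (sum) public
      open Multiples A using (_·ᶻ_) public
  open AbelianGroup B
  open Mult monoid using () renaming (_×_ to _·_)
  open Sum commutativeMonoid using (sum)
  open Multiples B using (_·ᶻ_)
  open GroupHomomorphism h

  hom-· : ∀ n x → ⟦ n A.· x ⟧ ≈ n · ⟦ x ⟧
  hom-· zero    x = ε-homo
  hom-· (suc n) x = trans (homo x (n A.· x)) (∙-congˡ (hom-· n x))

  hom-·ᶻ : ∀ a x → ⟦ a A.·ᶻ x ⟧ ≈ a ·ᶻ ⟦ x ⟧
  hom-·ᶻ (+ n)      x = hom-· n x
  hom-·ᶻ (-[1+ n ]) x = trans (⁻¹-homo (suc n A.· x)) (⁻¹-cong (hom-· (suc n) x))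

  hom-sum : ∀ {k} (x : Fin k → A.Carrier) → ⟦ A.sum x ⟧ ≈ sum (⟦_⟧ ∘ x)
  hom-sum {zero}  x = ε-homo
  hom-sum {suc k} x = trans (homo (x zero) (A.sum (x ∘ suc))) (∙-congˡ (hom-sum (x ∘ suc)))

-- Free abelian groups on finite sets

δ : ∀ {k} → Fin k → Fin k → ℤ
δ j i = if does (j ≟ᶠ i) then 1ℤ else 0ℤ

δ-diagonal : ∀ {k} (j : Fin k) → δ j j ≡ 1ℤ
δ-diagonal j with j ≟ᶠ j
... | yes _  = ≡.refl
... | no j≢j = contradiction ≡.refl j≢j

δ-off-diagonal : ∀ {k} {j i : Fin k} → j ≢ i → δ j i ≡ 0ℤ
δ-off-diagonal {j = j} {i} j≢i with j ≟ᶠ i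
... | yes j≡i = contradiction j≡i j≢i
... | no _    = ≡.refl

module _ where
  open Multiples ℤᴬ
  open Mult (AbelianGroup.monoid ℤᴬ) using () renaming (_×_ to _·_)

  ·-1 : ∀ n → n · 1ℤ ≡ + n
  ·-1 zero    = ≡.refl
  ·-1 (suc n) = ≡.cong (1ℤ +ᶻ_) (·-1 n)

  ·ᶻ-1 : ∀ a → a ·ᶻ 1ℤ ≡ a
  ·ᶻ-1 (+ n)      = ·-1 n
  ·ᶻ-1 (-[1+ n ]) = ≡.cong -ᶻ_ (·-1 (suc n))

  ·-0 : ∀ n → n · 0ℤ ≡ 0ℤ
  ·-0 zero    = ≡.refl
  ·-0 (suc n) = ≡.cong (0ℤ +ᶻ_) (·-0 n)

  ·ᶻ-0 : ∀ a → a ·ᶻ 0ℤ ≡ 0ℤ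
  ·ᶻ-0 (+ n)      = ·-0 n
  ·ᶻ-0 (-[1+ n ]) = ≡.cong -ᶻ_ (·-0 (suc n))

module FiniteBasis {Y : Set} {k : ℕ} (Y↔k : Y ↔ Fin k) where
  open Inverse Y↔k using (to; from; strictlyInverseˡ; strictlyInverseʳ)
  open FreeAb (≡.setoid Y) using (Word; gen)
  private
    F : Ab
    F = FreeOn Y
    module F = AbelianGroup F
    module Zᵏ = AbelianGroup (ℤ^ k)

  coordinate : Fin k → Hom F ℤᴬ
  coordinate i = extendFrom Y ℤᴬ (λ y → δ (to y) i)

  private module coordinate i = GroupHomomorphism (coordinate i)

  coordinates : Hom F (ℤ^ k)
  coordinates = makeHom F (ℤ^ k) (λ w i → coordinate.⟦_⟧ i w)
    (λ p i → coordinate.⟦⟧-cong i p) (λ x y i → coordinate.homo i x y)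

  open GroupHomomorphism coordinates using (⟦_⟧; isGroupHomomorphism)

  fromCoordinates : Hom (ℤ^ k) F
  fromCoordinates = Multiples.combination F (gen ∘ from)

  private module fromCoordinates = GroupHomomorphism fromCoordinates

  -- On a generator `y` the coordinates form a Kronecker delta, and only the term at `to y` survives
  -- in the sum.
  fromCoordinates-coordinates : ∀ w → fromCoordinates.⟦ ⟦ w ⟧ ⟧ F.≈ w
  fromCoordinates-coordinates = agree (≡.setoid Y) F
    (compose F (ℤ^ k) F fromCoordinates coordinates) (idHom F) on-generators
    where
    open Multiples F
    on-generators : ∀ y → fromCoordinates.⟦ ⟦ gen y ⟧ ⟧ F.≈ gen y
    on-generators y = begin
      fromCoordinates.⟦ ⟦ gen y ⟧ ⟧
        ≈⟨ sum-single (λ i → δ (to y) i ·ᶻ gen (from i)) (to y)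
             (λ i y≢i → F.reflexive (≡.cong (_·ᶻ gen (from i)) (δ-off-diagonal y≢i))) ⟩
      δ (to y) (to y) ·ᶻ gen (from (to y))
        ≡⟨ ≡.cong₂ (λ a z → a ·ᶻ gen z) (δ-diagonal (to y)) (strictlyInverseʳ y) ⟩
      -- `1ℤ ·ᶻ gen y` unfolds to `gen y` plus the empty multiple, which is the unit.
      1ℤ ·ᶻ gen y   ≈⟨ F.identityʳ (gen y) ⟩
      gen y         ∎
      where open SetoidReasoning F.setoid

  -- A map with a left inverse is injective. This is also what makes the generated congruence on
  -- words decidable, by comparing integers.
  coordinates-injective : ∀ w w′ → ⟦ w ⟧ Zᵏ.≈ ⟦ w′ ⟧ → w F.≈ w′
  coordinates-injective w w′ p = F.trans (F.sym (fromCoordinates-coordinates w))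
    (F.trans (fromCoordinates.⟦⟧-cong p) (fromCoordinates-coordinates w′))

  -- `coordinate i` commutes with sums and multiples, so it extracts the terms `a j ·ᶻ δ j i`, of
  -- which only `j = i` is nonzero.
  coordinates-fromCoordinates : ∀ a → ⟦ fromCoordinates.⟦ a ⟧ ⟧ Zᵏ.≈ a
  coordinates-fromCoordinates a i = begin
    coordinate.⟦_⟧ i (F-sum (λ j → a j ·ᶠ gen (from j)))
      ≡⟨ hom-sum F ℤᴬ (coordinate i) (λ j → a j ·ᶠ gen (from j)) ⟩
    sum (λ j → coordinate.⟦_⟧ i (a j ·ᶠ gen (from j)))
      ≡⟨ sum-cong-≋ term ⟩
    sum (λ j → a j ·ᶻ δ j i)
      ≡⟨ sum-single (λ j → a j ·ᶻ δ j i) i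
           (λ j i≢j → ≡.trans (≡.cong (a j ·ᶻ_) (δ-off-diagonal (i≢j ∘ ≡.sym))) (·ᶻ-0 (a j))) ⟩
    a i ·ᶻ δ i i   ≡⟨ ≡.cong (a i ·ᶻ_) (δ-diagonal i) ⟩
    a i ·ᶻ 1ℤ      ≡⟨ ·ᶻ-1 (a i) ⟩
    a i            ∎
    where
    open ≡.≡-Reasoning
    open Multiples ℤᴬ
    open Multiples F using () renaming (_·ᶻ_ to _·ᶠ_)
    open Sum F.commutativeMonoid using () renaming (sum to F-sum)
    open Sum (AbelianGroup.commutativeMonoid ℤᴬ) using (sum; sum-cong-≋)
    term : ∀ j → coordinate.⟦_⟧ i (a j ·ᶠ gen (from j)) ≡ a j ·ᶻ δ j i
    term j = ≡.trans (hom-·ᶻ F ℤᴬ (coordinate i) (a j) (gen (from j)))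
                     (≡.cong (λ l → a j ·ᶻ δ l i) (strictlyInverseˡ j))

  free≅ℤ^ : F ≅ ℤ^ k
  free≅ℤ^ = ⟦_⟧ , record
    { isGroupMonomorphism = record
      { isGroupHomomorphism = isGroupHomomorphism
      ; injective = λ {w} {w′} → coordinates-injective w w′
      }
    ; surjective = λ a → fromCoordinates.⟦ a ⟧ , λ {w} p →
        Zᵏ.trans {⟦ w ⟧} {⟦ fromCoordinates.⟦ a ⟧ ⟧} {a}
          (GroupHomomorphism.⟦⟧-cong coordinates p) (coordinates-fromCoordinates a)
    }

-- An identity of abelian groups holds as soon as it holds in the free abelian
-- group on its variables, where it is decided by comparing coordinates.
module Solver (G : Ab) {k : ℕ} (ρ : Vec ∣ G ∣ k) where
  open AbelianGroup G
  open FreeAb (≡.setoid (Fin k)) using (Word)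
  open FiniteBasis (↔-id (Fin k)) using (coordinate; coordinates-injective)
  private module coordinate i = GroupHomomorphism (coordinate i)

  open GroupHomomorphism (extendFrom (Fin k) G (lookup ρ))

  solve : ∀ (w w′ : Word)
          {_ : True (all? (λ i → coordinate.⟦_⟧ i w ℤ.≟ coordinate.⟦_⟧ i w′))} →
          ⟦ w ⟧ ≈ ⟦ w′ ⟧
  solve w w′ {p} = ⟦⟧-cong (coordinates-injective w w′ (toWitness p))

-- Homology from contraction data

module _ (XA XB : Setoid 0ℓ 0ℓ) (D : Ab)
         (d′ : Hom (Free XA) (Free XB)) (d : Hom (Free XB) D) (Y : Set) where
  open FreeAb using (gen)
  private
    FY : Ab
    FY = FreeOn Y
    module FY = AbelianGroup FY
    module XB = AbelianGroup (Free XB)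
    module D  = AbelianGroup D
    module d′ = GroupHomomorphism d′
    module d  = GroupHomomorphism d

  -- FreeOn Y as a deformation retract of the complex Free XA → Free XB → D at its
  -- middle term; s and t form the contracting homotopy.
  record Contraction : Set where
    field
      fᴴ : Hom (Free XB) FY
      gᴴ : Hom FY (Free XB)
      sᴴ : Hom (Free XB) (Free XA)
      tᴴ : Hom D (Free XB)

    module f = GroupHomomorphism fᴴ
    module g = GroupHomomorphism gᴴ
    module s = GroupHomomorphism sᴴ
    module t = GroupHomomorphism tᴴ

    field
      f∘d′     : ∀ a → f.⟦ d′.⟦ gen a ⟧ ⟧ FY.≈ FY.ε
      d∘g      : ∀ y → d.⟦ g.⟦ gen y ⟧ ⟧ D.≈ D.ε
      f∘g      : ∀ y → f.⟦ g.⟦ gen y ⟧ ⟧ FY.≈ gen y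
      homotopy : ∀ b → g.⟦ f.⟦ gen b ⟧ ⟧ XB.∙ (d′.⟦ s.⟦ gen b ⟧ ⟧ XB.∙ t.⟦ d.⟦ gen b ⟧ ⟧)
                       XB.≈ gen b

  module _ (dd : ∀ x → d.⟦ d′.⟦ x ⟧ ⟧ D.≈ D.ε) (contraction : Contraction) where
    open Contraction contraction

    private
      H : Ab
      H = ker/im (Free XA) (Free XB) D d′ d dd

      f∘d′-vanishes : ∀ x → f.⟦ d′.⟦ x ⟧ ⟧ FY.≈ FY.ε
      f∘d′-vanishes = FreeAb.vanish XA FY (compose (Free XA) (Free XB) FY fᴴ d′) f∘d′

      d∘g-vanishes : ∀ y → d.⟦ g.⟦ y ⟧ ⟧ D.≈ D.ε
      d∘g-vanishes = FreeAb.vanish (≡.setoid Y) D (compose FY (Free XB) D d gᴴ) d∘g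

      f∘g≈id : ∀ y → f.⟦ g.⟦ y ⟧ ⟧ FY.≈ y
      f∘g≈id = agree (≡.setoid Y) FY (compose FY (Free XB) FY fᴴ gᴴ) (idHom FY) f∘g

      homotopic : ∀ x → g.⟦ f.⟦ x ⟧ ⟧ XB.∙ (d′.⟦ s.⟦ x ⟧ ⟧ XB.∙ t.⟦ d.⟦ x ⟧ ⟧) XB.≈ x
      -- The left side of the homotopy identity is assembled as a single homomorphism so that it can
      -- be compared with the identity on generators.
      homotopic = agree XB (Free XB)
        (plus (Free XB) (Free XB) (compose (Free XB) FY (Free XB) gᴴ fᴴ)
          (plus (Free XB) (Free XB) (compose (Free XB) (Free XA) (Free XB) d′ sᴴ)
                                    (compose (Free XB) D (Free XB) tᴴ d)))
        (idHom (Free XB)) homotopy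

      -- When both `f` and `d` kill `x`, the homotopy identity keeps only its middle term, which
      -- exhibits `x` as the boundary of `s x`.
      bounds : ∀ x → f.⟦ x ⟧ FY.≈ FY.ε → d.⟦ x ⟧ D.≈ D.ε → d′.⟦ s.⟦ x ⟧ ⟧ XB.≈ x
      bounds x fx≈ε dx≈ε = begin
        d′.⟦ s.⟦ x ⟧ ⟧                              ≈⟨ XB.identityʳ _ ⟨
        d′.⟦ s.⟦ x ⟧ ⟧ ∙ ε                          ≈⟨ XB.∙-congˡ (XB.trans (t.⟦⟧-cong dx≈ε) t.ε-homo) ⟨
        d′.⟦ s.⟦ x ⟧ ⟧ ∙ t.⟦ d.⟦ x ⟧ ⟧              ≈⟨ XB.identityˡ _ ⟨
        ε ∙ (d′.⟦ s.⟦ x ⟧ ⟧ ∙ t.⟦ d.⟦ x ⟧ ⟧)        ≈⟨ XB.∙-congʳ (XB.trans (g.⟦⟧-cong fx≈ε) g.ε-homo) ⟨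
        g.⟦ f.⟦ x ⟧ ⟧ ∙ (d′.⟦ s.⟦ x ⟧ ⟧ ∙ t.⟦ d.⟦ x ⟧ ⟧)  ≈⟨ homotopic x ⟩
        x                                           ∎
        where
        open SetoidReasoning XB.setoid
        open XB using (_∙_; ε)

      φ : Hom H FY
      φ = makeHom H FY (λ (x , _) → f.⟦ x ⟧)
        -- If `x - y` is the boundary of `a`, then `f` kills it because `f` kills boundaries.
        (λ { {x , _} {y , _} (a , p) → minus-vanishes⇒≈ (Free XB) FY fᴴ x y
               (FY.trans (f.⟦⟧-cong (XB.sym p)) (f∘d′-vanishes a)) })
        (λ (x , _) (y , _) → f.homo x y)

    -- The isomorphism is `f` restricted to cycles. Injectivity comes from `bounds` applied to a
    -- difference, surjectivity from the section `g`, whose values are cycles.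
    contraction⇒≅ : H ≅ FY
    contraction⇒≅ = GroupHomomorphism.⟦_⟧ φ , record
      { isGroupMonomorphism = record
        { isGroupHomomorphism = GroupHomomorphism.isGroupHomomorphism φ
        ; injective = λ { {x , dx} {y , dy} p → s.⟦ x XB.- y ⟧ ,
            bounds (x XB.- y) (≈⇒minus-vanishes (Free XB) FY fᴴ x y p)
              (≈⇒minus-vanishes (Free XB) D d x y (D.trans dx (D.sym dy))) }
        }
      ; surjective = λ y → (g.⟦ y ⟧ , d∘g-vanishes y) , λ {z} p →
          FY.trans (GroupHomomorphism.⟦⟧-cong φ {z} {g.⟦ y ⟧ , d∘g-vanishes y} p) (f∘g≈id y)
      }

ℤ^0≅𝟎 : ℤ^ 0 ≅ 𝟎
ℤ^0≅𝟎 = _ , record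
  { isGroupMonomorphism = record
    { isGroupHomomorphism = GroupHomomorphism.isGroupHomomorphism
        (makeHom (ℤ^ 0) 𝟎 _ (λ _ → _) (λ _ _ → _))
    ; injective = λ _ ()
    }
  ; surjective = λ _ → (λ ()) , λ _ → _
  }

-- The tile complex of κ (suc m) (suc n)

module TileComplex (m n : ℕ) where
  private
    G : BipartiteGraph
    G = κ (suc m) (suc n)

  open LabelledSquares (TC G)
  open ChainComplex augmented using (∂∂≈0)

  private
    C₀ = Chains 0
    C₁ = Chains 1
    C₂ = Chains 2
    module C₀ = AbelianGroup C₀
    module C₁ = AbelianGroup C₁
    module C₂ = AbelianGroup C₂
    module ∂₀ = GroupHomomorphism (boundary 0)
    module ∂₁ = GroupHomomorphism (boundary 1)
    module F₀ = FreeAb (Cell 0)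
    module F₁ = FreeAb (Cell 1)
    module F₂ = FreeAb (Cell 2)

  -- Representatives of the cells and the classification of vertices

  P : Fin 4 → ∣ C₀ ∣
  P k = F₀.gen ((zero , zero) , k)

  -- A section of `edgeLabel`: each label is represented on a square whose other index is the base
  -- index, so every 1-chain can be written with the generators `E`.
  edge : TileLabel G → Edge
  edge (u¹ i) = (i , zero) , 0F
  edge (v¹ j) = (zero , j) , 1F
  edge (u² i) = (i , zero) , 2F
  edge (v² j) = (zero , j) , 3F

  E : TileLabel G → ∣ C₁ ∣
  E ℓ = F₁.gen (edge ℓ)

  A : Fin (suc m) → Fin (suc n) → ∣ C₂ ∣
  A i j = F₂.gen (i , j)

  E-edgeLabel : ∀ e → E (edgeLabel e) C₁.≈ F₁.gen e
  E-edgeLabel ((i , j) , 0F) = F₁.gen-cong ≡.refl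
  E-edgeLabel ((i , j) , 1F) = F₁.gen-cong ≡.refl
  E-edgeLabel ((i , j) , 2F) = F₁.gen-cong ≡.refl
  E-edgeLabel ((i , j) , 3F) = F₁.gen-cong ≡.refl

  private
    glue-sources : ∀ e e′ → edgeLabel e ≡ edgeLabel e′ →
                   EqClosure.EqClosure Glued (source e) (source e′)
    glue-sources e e′ p = EqClosure.return (sources {e} {e′} p)

    glue-targets : ∀ e e′ → edgeLabel e ≡ edgeLabel e′ →
                   EqClosure.EqClosure Glued (target e) (target e′)
    glue-targets e e′ p = EqClosure.return (targets {e} {e′} p)

    _then_ : ∀ {x y z} → EqClosure.EqClosure Glued x y → EqClosure.EqClosure Glued y z →
             EqClosure.EqClosure Glued x z
    _then_ = EqClosure.transitive Glued

  -- Of the two sides of A i j at a corner one has a label that depends on i only,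
  -- the other a label that depends on j only; moving along them brings first j and
  -- then i to zero.
  corners-glued : ∀ s k → EqClosure.EqClosure Glued (s , k) ((zero , zero) , k)
  corners-glued (i , j) 0F = glue-sources ((i , j) , 0F) ((i , zero) , 0F) ≡.refl then
                             glue-targets ((i , zero) , 3F) ((zero , zero) , 3F) ≡.refl
  corners-glued (i , j) 1F = glue-targets ((i , j) , 0F) ((i , zero) , 0F) ≡.refl then
                             glue-sources ((i , zero) , 1F) ((zero , zero) , 1F) ≡.refl
  corners-glued (i , j) 2F = glue-sources ((i , j) , 2F) ((i , zero) , 2F) ≡.refl then
                             glue-targets ((i , zero) , 1F) ((zero , zero) , 1F) ≡.refl
  corners-glued (i , j) 3F = glue-targets ((i , j) , 2F) ((i , zero) , 2F) ≡.refl then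
                             glue-sources ((i , zero) , 3F) ((zero , zero) , 3F) ≡.refl

  -- The kind of a label records which side of a square it marks; this is the invariant that keeps
  -- the four vertices apart.
  position : TileLabel G → Fin 4
  position (u¹ _) = 0F
  position (v¹ _) = 1F
  position (u² _) = 2F
  position (v² _) = 3F

  position-edgeLabel : ∀ e → position (edgeLabel e) ≡ proj₂ e
  position-edgeLabel (s , 0F) = ≡.refl
  position-edgeLabel (s , 1F) = ≡.refl
  position-edgeLabel (s , 2F) = ≡.refl
  position-edgeLabel (s , 3F) = ≡.refl

  same-label⇒same-position : ∀ e e′ → edgeLabel e ≡ edgeLabel e′ → proj₂ e ≡ proj₂ e′
  same-label⇒same-position e e′ p =
    ≡.trans (≡.sym (position-edgeLabel e)) (≡.trans (≡.cong position p) (position-edgeLabel e′))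

  -- Equal labels force equal sides, hence equal sources and, through `next`, equal targets. So any
  -- function of the position respects gluing and defines a homomorphism on 0-chains.
  glued⇒same-position : ∀ {c c′} → EqClosure.EqClosure Glued c c′ → proj₂ c ≡ proj₂ c′
  glued⇒same-position = EqClosure.gfold ≡.isEquivalence proj₂ λ where
    (sources {e} {e′} p) → same-label⇒same-position e e′ p
    (targets {e} {e′} p) → ≡.cong next (same-label⇒same-position e e′ p)

  corner≈P : ∀ s k → F₀.gen (s , k) C₀.≈ P k
  corner≈P s k = F₀.gen-cong (corners-glued s k)

  boundary-edge : ∀ s k → ∂₀.⟦ F₁.gen (s , k) ⟧ C₀.≈ P (next k) C₀.- P k
  boundary-edge s k = C₀.∙-cong (corner≈P s (next k)) (C₀.⁻¹-cong (corner≈P s k))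

  -- Each side of `A i j` is traded for the representative with the same label, and the trailing
  -- unit of the sum is dropped.
  boundary-square : ∀ i j → ∂₁.⟦ A i j ⟧ C₁.≈ E (u¹ i) C₁.∙ (E (v¹ j) C₁.∙ (E (u² i) C₁.∙ E (v² j)))
  boundary-square i j = C₁.∙-cong (F₁.gen-cong ≡.refl) (C₁.∙-cong (F₁.gen-cong ≡.refl)
    (C₁.∙-cong (F₁.gen-cong ≡.refl) (C₁.trans (C₁.identityʳ _) (F₁.gen-cong ≡.refl))))

  -- Homomorphisms defined on vertices and labels, and the contracting homotopy

  fromPositions : (B : Ab) → (Fin 4 → ∣ B ∣) → Hom C₀ B
  fromPositions B h = FreeAb.extend (Cell 0) B (record
    { to = h ∘ proj₂
    ; cong = λ p → AbelianGroup.reflexive B (≡.cong h (glued⇒same-position p)) })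

  fromLabels : (B : Ab) → (TileLabel G → ∣ B ∣) → Hom C₁ B
  fromLabels B h = FreeAb.extend (Cell 1) B (record
    { to = h ∘ edgeLabel ; cong = AbelianGroup.reflexive B ∘ ≡.cong h })

  s₀ : Hom C₀ C₁
  s₀ = fromPositions C₁ λ where
      0F → ε
      1F → E (u¹ zero)
      2F → E (u¹ zero) ∙ E (v¹ zero)
      3F → E (u¹ zero) ∙ (E (v¹ zero) ∙ E (u² zero))
    where open C₁ using (ε; _∙_)

  s₁ : Hom C₁ C₂
  s₁ = fromLabels C₂ λ where
      (u¹ i) → A i zero - A zero zero
      (v¹ j) → A zero j - A zero zero
      (u² i) → ε
      (v² j) → A zero zero
    where open C₂ using (ε; _-_)

  private
    -- Variable names for the words given to `solve`: each stands for the entry with that index in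
    -- the accompanying vector.
    pattern a = FreeAb.gen 0F
    pattern b = FreeAb.gen 1F
    pattern c = FreeAb.gen 2F
    pattern d = FreeAb.gen 3F
    pattern h = FreeAb.gen 4F
    pattern l = FreeAb.gen 5F
    pattern p = FreeAb.gen 6F
    pattern q = FreeAb.gen 7F

    open FreeAb using (𝟘; _⊕_; ⊖_)

  -- Degree 0

  H₀ : H̃ 0 (TC G) ≅ FreeOn (Fin 0)
  H₀ = contraction⇒≅ (Cell 1) (Cell 0) ℤᴬ (boundary 0) augmentation (Fin 0) (∂∂≈0 0) (record
    { fᴴ = zeroHom C₀ (FreeOn (Fin 0))
    ; gᴴ = extendFrom (Fin 0) C₀ λ ()
    ; sᴴ = s₀
    -- The homotopy out of degree -1 sends 1 to the base vertex.
    ; tᴴ = Multiples.multiples C₀ (P 0F)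
    ; f∘d′ = λ _ → AbelianGroup.refl (FreeOn (Fin 0))
    ; d∘g = λ () ; f∘g = λ ()
    ; homotopy = λ (s , k) → C₀.trans (homotopy k) (C₀.sym (corner≈P s k))
    })
    where
    module s₀ = GroupHomomorphism s₀
    open Solver C₀ (P 0F ∷ P 1F ∷ P 2F ∷ P 3F ∷ []) using (solve)

    homotopy : ∀ k → C₀.ε C₀.∙ (∂₀.⟦ s₀.⟦ P k ⟧ ⟧ C₀.∙ (P 0F C₀.∙ C₀.ε)) C₀.≈ P k
    -- The words spell out what the maps unfold to: the boundary of the path to `P k` telescopes to
    -- `P k - P 0F`, and the base vertex restores the missing term.
    homotopy 0F = solve (𝟘 ⊕ (𝟘 ⊕ (a ⊕ 𝟘))) a
    homotopy 1F = solve (𝟘 ⊕ ((b ⊕ ⊖ a) ⊕ (a ⊕ 𝟘))) b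
    homotopy 2F = solve (𝟘 ⊕ (((b ⊕ ⊖ a) ⊕ (c ⊕ ⊖ b)) ⊕ (a ⊕ 𝟘))) c
    homotopy 3F = solve (𝟘 ⊕ (((b ⊕ ⊖ a) ⊕ ((c ⊕ ⊖ b) ⊕ (d ⊕ ⊖ c))) ⊕ (a ⊕ 𝟘))) d

  -- Degree 1

  module _ where
    private
      Y₁ : Set
      Y₁ = Fin m ⊎ Fin n
      F : Ab
      F = FreeOn Y₁
      module F = AbelianGroup F

      -- `x i` stands for the class of `u² i - u² 0`, and `y j` for that of `v² j - v² 0`; both are
      -- therefore zero at the base index.
      x : Fin (suc m) → ∣ F ∣
      x zero    = F.ε
      x (suc i) = FreeAb.gen (inj₁ i)

      y : Fin (suc n) → ∣ F ∣
      y zero    = F.ε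
      y (suc j) = FreeAb.gen (inj₂ j)

      f : Hom C₁ F
      f = fromLabels F λ where
        (u¹ i) → x i F.⁻¹
        (v¹ j) → y j F.⁻¹
        (u² i) → x i
        (v² j) → y j

      g : Y₁ → ∣ C₁ ∣
      g (inj₁ i) = E (u² (suc i)) C₁.- E (u² zero)
      g (inj₂ j) = E (v² (suc j)) C₁.- E (v² zero)

      gᴴ : Hom F C₁
      gᴴ = extendFrom Y₁ C₁ g

      module f = GroupHomomorphism f
      module g = GroupHomomorphism gᴴ
      module s₀ = GroupHomomorphism s₀
      module s₁ = GroupHomomorphism s₁

      -- The opposite signs given to `u¹` and `u²`, and to `v¹` and `v²`, make the four sides cancel
      -- in pairs.
      f∘∂ : ∀ s → f.⟦ ∂₁.⟦ F₂.gen s ⟧ ⟧ F.≈ F.ε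
      f∘∂ (i , j) = solve (⊖ a ⊕ (⊖ b ⊕ (a ⊕ (b ⊕ 𝟘)))) 𝟘
        where open Solver F (x i ∷ y j ∷ []) using (solve)

      -- All edges `u²` run from position 2 to position 3, and all `v²` from 3 to 0, so two edges of
      -- the same kind have equal boundaries.
      ∂∘g : ∀ z → ∂₀.⟦ g z ⟧ C₀.≈ C₀.ε
      ∂∘g (inj₁ i) = C₀.trans
        (C₀.∙-cong (boundary-edge (suc i , zero) 2F) (C₀.⁻¹-cong (boundary-edge (zero , zero) 2F)))
        (C₀.inverseʳ _)
      ∂∘g (inj₂ j) = C₀.trans
        (C₀.∙-cong (boundary-edge (zero , suc j) 3F) (C₀.⁻¹-cong (boundary-edge (zero , zero) 3F)))
        (C₀.inverseʳ _)

      f∘g : ∀ z → f.⟦ g z ⟧ F.≈ FreeAb.gen z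
      f∘g (inj₁ i) = solve (a ⊕ ⊖ 𝟘) a
        where open Solver F (FreeAb.gen (inj₁ i) ∷ []) using (solve)
      f∘g (inj₂ j) = solve (a ⊕ ⊖ 𝟘) a
        where open Solver F (FreeAb.gen (inj₂ j) ∷ []) using (solve)

      -- One formula covering the base index, where both sides vanish; it spares `homotopy` a case
      -- distinction on `i`.
      g-x : ∀ i → g.⟦ x i ⟧ C₁.≈ E (u² i) C₁.- E (u² zero)
      g-x zero    = C₁.sym (C₁.inverseʳ _)
      g-x (suc i) = C₁.refl

      g-y : ∀ j → g.⟦ y j ⟧ C₁.≈ E (v² j) C₁.- E (v² zero)
      g-y zero    = C₁.sym (C₁.inverseʳ _)
      g-y (suc j) = C₁.refl

      homotopy : ∀ e → g.⟦ f.⟦ F₁.gen e ⟧ ⟧ C₁.∙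
                         (∂₁.⟦ s₁.⟦ F₁.gen e ⟧ ⟧ C₁.∙ s₀.⟦ ∂₀.⟦ F₁.gen e ⟧ ⟧) C₁.≈ F₁.gen e
      homotopy e = C₁.trans (on-label e) (E-edgeLabel e)
        where
        on-label : ∀ e → g.⟦ f.⟦ F₁.gen e ⟧ ⟧ C₁.∙
                     (∂₁.⟦ s₁.⟦ F₁.gen e ⟧ ⟧ C₁.∙ s₀.⟦ ∂₀.⟦ F₁.gen e ⟧ ⟧) C₁.≈ E (edgeLabel e)
        -- `g ∘ f` contributes `-(u² i - u² 0)`, the boundary of `A i 0 - A 0 0` cancels it and
        -- leaves `u¹ i - u¹ 0`, and the paths contribute `u¹ 0`. The case of `v¹ j` is symmetric.
        on-label ((i , j) , 0F) = C₁.trans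
          (C₁.∙-cong (C₁.⁻¹-cong (g-x i)) (C₁.∙-congʳ (C₁.∙-cong (boundary-square i zero)
            (C₁.⁻¹-cong (boundary-square zero zero)))))
          (solve (⊖ (c ⊕ ⊖ d) ⊕ (((a ⊕ (h ⊕ (c ⊕ l))) ⊕ ⊖ (b ⊕ (h ⊕ (d ⊕ l)))) ⊕ (b ⊕ ⊖ 𝟘))) a)
          where open Solver C₁ (E (u¹ i) ∷ E (u¹ zero) ∷ E (u² i) ∷ E (u² zero)
                                 ∷ E (v¹ zero) ∷ E (v² zero) ∷ []) using (solve)
        on-label ((i , j) , 1F) = C₁.trans
          (C₁.∙-cong (C₁.⁻¹-cong (g-y j)) (C₁.∙-congʳ (C₁.∙-cong (boundary-square zero j)
            (C₁.⁻¹-cong (boundary-square zero zero)))))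
          (solve (⊖ (c ⊕ ⊖ d) ⊕ (((h ⊕ (a ⊕ (l ⊕ c))) ⊕ ⊖ (h ⊕ (b ⊕ (l ⊕ d))))
                                  ⊕ ((h ⊕ b) ⊕ ⊖ h))) a)
          where open Solver C₁ (E (v¹ j) ∷ E (v¹ zero) ∷ E (v² j) ∷ E (v² zero)
                                 ∷ E (u¹ zero) ∷ E (u² zero) ∷ []) using (solve)
        on-label ((i , j) , 2F) = C₁.trans
          (C₁.∙-congʳ (g-x i))
          (solve ((a ⊕ ⊖ b) ⊕ (𝟘 ⊕ ((c ⊕ (d ⊕ b)) ⊕ ⊖ (c ⊕ d)))) a)
          where open Solver C₁ (E (u² i) ∷ E (u² zero) ∷ E (u¹ zero) ∷ E (v¹ zero) ∷ []) using (solve)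
        -- The target is the base vertex, whose path is empty, so the paths contribute minus the
        -- three sides leading to `P 3F`; the boundary of `A 0 0` cancels these and supplies `v² 0`.
        on-label ((i , j) , 3F) = C₁.trans
          (C₁.∙-cong (g-y j) (C₁.∙-congʳ (boundary-square zero zero)))
          (solve ((a ⊕ ⊖ b) ⊕ ((c ⊕ (d ⊕ (h ⊕ b))) ⊕ (𝟘 ⊕ ⊖ (c ⊕ (d ⊕ h))))) a)
          where open Solver C₁ (E (v² j) ∷ E (v² zero) ∷ E (u¹ zero) ∷ E (v¹ zero)
                                 ∷ E (u² zero) ∷ []) using (solve)

    H₁ : H̃ 1 (TC G) ≅ F
    H₁ = contraction⇒≅ (Cell 2) (Cell 1) C₀ (boundary 1) (boundary 0) Y₁ (∂∂≈0 1) (record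
      { fᴴ = f ; gᴴ = gᴴ ; sᴴ = s₁ ; tᴴ = s₀
      ; f∘d′ = f∘∂ ; d∘g = ∂∘g ; f∘g = f∘g ; homotopy = homotopy
      })

  -- Degree 2

  module _ where
    private
      Y₂ : Set
      Y₂ = Fin m × Fin n
      F : Ab
      F = FreeOn Y₂
      module F = AbelianGroup F

      -- Reads off the coefficients at squares with both indices nonzero; by the homotopy below
      -- these determine a cycle.
      f : Hom C₂ F
      f = extendFrom Square F λ where
        (suc i , suc j) → FreeAb.gen (i , j)
        (zero  , _    ) → F.ε
        (suc _ , zero ) → F.ε

      g : Y₂ → ∣ C₂ ∣
      g (i , j) = (A (suc i) (suc j) - A (suc i) zero) - (A zero (suc j) - A zero zero)
        where open C₂ using (_-_)

      gᴴ : Hom F C₂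
      gᴴ = extendFrom Y₂ C₂ g

      module f = GroupHomomorphism f
      module g = GroupHomomorphism gᴴ
      module s₁ = GroupHomomorphism s₁

      -- The boundary of `A i j` is a term in `i` plus a term in `j`, so its mixed second difference
      -- vanishes.
      ∂∘g : ∀ z → ∂₁.⟦ g z ⟧ C₁.≈ C₁.ε
      ∂∘g (i , j) = C₁.trans
        (C₁.∙-cong
          (C₁.∙-cong (boundary-square (suc i) (suc j)) (C₁.⁻¹-cong (boundary-square (suc i) zero)))
          (C₁.⁻¹-cong
            (C₁.∙-cong (boundary-square zero (suc j)) (C₁.⁻¹-cong (boundary-square zero zero)))))
        (solve (((a ⊕ (b ⊕ (c ⊕ d))) ⊕ ⊖ (a ⊕ (p ⊕ (c ⊕ q))))
                ⊕ ⊖ ((h ⊕ (b ⊕ (l ⊕ d))) ⊕ ⊖ (h ⊕ (p ⊕ (l ⊕ q))))) 𝟘)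
        where open Solver C₁ (E (u¹ (suc i)) ∷ E (v¹ (suc j)) ∷ E (u² (suc i)) ∷ E (v² (suc j))
                               ∷ E (u¹ zero) ∷ E (u² zero) ∷ E (v¹ zero) ∷ E (v² zero) ∷ []) using (solve)

      f∘g : ∀ z → f.⟦ g z ⟧ F.≈ FreeAb.gen z
      f∘g z = solve ((a ⊕ ⊖ 𝟘) ⊕ ⊖ (𝟘 ⊕ ⊖ 𝟘)) a
        where open Solver F (FreeAb.gen z ∷ []) using (solve)

      -- `s₁` of the boundary of `A i j` is `A i 0 + A 0 j - A 0 0`. This is `A i j` itself if an
      -- index is zero, and otherwise exactly what `g` subtracts. The middle `C₂.ε` reflects that
      -- there are no 3-cells.
      homotopy : ∀ s → g.⟦ f.⟦ F₂.gen s ⟧ ⟧ C₂.∙ (C₂.ε C₂.∙ s₁.⟦ ∂₁.⟦ F₂.gen s ⟧ ⟧) C₂.≈ F₂.gen s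
      homotopy (zero , j) =
        solve (𝟘 ⊕ (𝟘 ⊕ ((a ⊕ ⊖ a) ⊕ ((b ⊕ ⊖ a) ⊕ (𝟘 ⊕ (a ⊕ 𝟘)))))) b
        where open Solver C₂ (A zero zero ∷ A zero j ∷ []) using (solve)
      homotopy (suc i , zero) =
        solve (𝟘 ⊕ (𝟘 ⊕ ((b ⊕ ⊖ a) ⊕ ((a ⊕ ⊖ a) ⊕ (𝟘 ⊕ (a ⊕ 𝟘)))))) b
        where open Solver C₂ (A zero zero ∷ A (suc i) zero ∷ []) using (solve)
      homotopy (suc i , suc j) =
        solve (((d ⊕ ⊖ b) ⊕ ⊖ (c ⊕ ⊖ a)) ⊕ (𝟘 ⊕ ((b ⊕ ⊖ a) ⊕ ((c ⊕ ⊖ a) ⊕ (𝟘 ⊕ (a ⊕ 𝟘)))))) d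
        where open Solver C₂ (A zero zero ∷ A (suc i) zero ∷ A zero (suc j) ∷ A (suc i) (suc j) ∷ [])
                using (solve)

    H₂ : H̃ 2 (TC G) ≅ F
    H₂ = contraction⇒≅ (Cell 3) (Cell 2) C₁ (boundary 2) (boundary 1) Y₂ (∂∂≈0 2) (record
      { fᴴ = f ; gᴴ = gᴴ ; sᴴ = zeroHom C₂ (Chains 3) ; tᴴ = s₁
      ; f∘d′ = λ () ; d∘g = ∂∘g ; f∘g = f∘g ; homotopy = homotopy
      })

  -- Degrees 3 and above

  Hₖ₊₃ : ∀ k → H̃ (3 + k) (TC G) ≅ FreeOn (Fin 0)
  Hₖ₊₃ k = contraction⇒≅ (Cell (4 + k)) (Cell (3 + k)) (Chains (2 + k))
    (boundary (3 + k)) (boundary (2 + k)) (Fin 0) (∂∂≈0 (3 + k)) (record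
    { fᴴ = zeroHom (Chains (3 + k)) (FreeOn (Fin 0))
    ; gᴴ = extendFrom (Fin 0) (Chains (3 + k)) λ ()
    ; sᴴ = zeroHom (Chains (3 + k)) (Chains (4 + k))
    ; tᴴ = zeroHom (Chains (2 + k)) (Chains (3 + k))
    -- Each condition ranges over the cells of a dimension above two or over `Fin 0`, hence over an
    -- empty type.
    ; f∘d′ = λ () ; d∘g = λ () ; f∘g = λ () ; homotopy = λ ()
    })

-- Ranks of the homology groups

free≅𝟎 : FreeOn (Fin 0) ≅ 𝟎
free≅𝟎 = ≅-trans (FreeOn (Fin 0)) (ℤ^ 0) 𝟎 (FiniteBasis.free≅ℤ^ (↔-id (Fin 0))) ℤ^0≅𝟎

theorem6p1 : ∀ (α β : ℕ) → 2 ≤ α → 2 ≤ β →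
    (H̃ 0 (TC (κ α β)) ≅ 𝟎)
    × (H̃ 1 (TC (κ α β)) ≅ ℤ^ (α + β ∸ 2))
    × (H̃ 2 (TC (κ α β)) ≅ ℤ^ ((α ∸ 1) * (β ∸ 1)))
    × (∀ (n : ℕ) → 3 ≤ n → H̃ n (TC (κ α β)) ≅ 𝟎)
theorem6p1 (suc m) (suc n) _ _ =
    ≅-trans (H̃ 0 X) (FreeOn (Fin 0)) 𝟎 H₀ free≅𝟎
  -- The stated rank reduces to `(m + suc n) ∸ 1`, which becomes `m + n` only after the successor is
  -- moved to the front.
  , ≡.subst (λ r → H̃ 1 X ≅ ℤ^ (r ∸ 1)) (≡.sym (+-suc m n))
      (≅-trans (H̃ 1 X) (FreeOn (Fin m ⊎ Fin n)) (ℤ^ (m + n)) H₁ (FiniteBasis.free≅ℤ^ (↔-sym +↔⊎)))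
  , ≅-trans (H̃ 2 X) (FreeOn (Fin m × Fin n)) (ℤ^ (m * n)) H₂ (FiniteBasis.free≅ℤ^ (↔-sym *↔×))
  , λ { (suc (suc (suc k))) _ → ≅-trans (H̃ (3 + k) X) (FreeOn (Fin 0)) 𝟎 (Hₖ₊₃ k) free≅𝟎
      ; (suc zero) (s≤s ()) ; (suc (suc zero)) (s≤s (s≤s ())) }
  where
  open TileComplex m n
  X = TC (κ (suc m) (suc n))
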